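{- Let $m\ge1$. Identify $\mathcal A(\mathbf B^m)$ with the set of antichains $A\in\mathcal A(\mathbf A^{2m-1})$ that are invariant under the reflection $[i,j]\mapsto[2m-j,2m-i]$. Then \[|\{A\in\mathcal A(\mathbf B^m):\mathrm{LK}_{\mathcal A}(\rho_{\mathcal A}(A))=A\}|=2^m,\] where $\mathrm{LK}_{\mathcal A}$ and $\rho_{\mathcal A}$ are the corresponding maps on $\mathcal A(\mathbf A^{2m-1})$.
   Context: $\mathbf A^{n-1}$ is the poset of intervals $\{[i,j]:1\le i\le j\le n-1\}$ ordered by inclusion (type $A$ positive root poset); here $n=2m$. $\mathbf B^m$ is the poset of intervals $\{[i,j]:1\le i\le j\le 2m-1,\ i+j\le 2m\}$ ordered by inclusion (type $B$ positive root poset). $\mathcal A(\cdot)$ denotes the set of antichains. The identification of $\mathcal A(\mathbf B^m)$ with reflection-invariant antichains of $\mathbf A^{2m-1}$ is $A\mapsto\hat A=\{[i,j]:[i,j]\in A\text{ or }[2m-j,2m-i]\in A\}$. Antichain rowmotion $\rho_{\mathcal A}:\mathcal A(\mathbf A^{n-1})\to\mathcal A(\mathbf A^{n-1})$ sends an antichain $A$ to the set of minimal elements of the complement of the order ideal generated by $A$. $\mathrm{LK}_{\mathcal A}:\mathcal A(\mathbf A^{n-1})\to\mathcal A(\mathbf A^{n-1})$ (the Lalanne--Kreweras involution on antichains, due in this form to Panyushev) sends $\{[i_1,j_1],\dots,[i_k,j_k]\}$ to $\{[i'_1,j'_1],\dots,[i'_{n-k-1},j'_{n-k-1}]\}$,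 where $i'_1<\dots<i'_{n-k-1}$ are the elements of $\{1,\dots,n-1\}\setminus\{j_1,\dots,j_k\}$ and $j'_1<\dots<j'_{n-k-1}$ are the elements of $\{1,\dots,n-1\}\setminus\{i_1,\dots,i_k\}$. -}

module Defs where

open import Level using (0ℓ; _⊔_) renaming (suc to lsuc)
open import Data.Nat using (ℕ; suc; _+_; _*_; _∸_; _≤_; _<_; _≤?_; _<?_; _≟_; s≤s)
open import Data.Nat.Properties
open import Data.Fin using (Fin)
open import Data.List using (List; []; _∷_; applyUpTo; filter; zip)
open import Data.List.Membership.Propositional using (_∈_)
import Data.List.Membership.DecPropositional as DecMembership
open import Data.List.Relation.Unary.All as All using ()
open import Data.List.Relation.Unary.Any using (here; there)
open import Data.List.Relation.Unary.AllPairs using (AllPairs; _∷_)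
import Data.List.Relation.Unary.AllPairs.Properties as AllPairs
open import Data.Product using (Σ; ∃; _×_; _,_; proj₁; proj₂; Σ-syntax; ∃-syntax)
open import Data.Product.Properties using (≡-dec)
open import Data.Sum using (_⊎_; inj₁; inj₂)
open import Function using (_∘_)
open import Function.Bundles using (Inverse)
open import Relation.Nullary using (Dec; yes; no; ¬?; contradiction; Irrelevant)
open import Relation.Nullary.Decidable using (map′; _×-dec_; _⊎-dec_; decidable-stable)
open import Relation.Unary using (Pred; Decidable; ∁)
open import Relation.Unary.Properties using (∁?)
open import Relation.Unary.Relation.Binary.Equality using (≐-setoid)
open import Relation.Binary using (Poset; Setoid; Rel; _Respects_; IsPartialOrder)
import Relation.Binary as B
import Relation.Binary.Construct.On as On
open import Relation.Binary.PropositionalEquality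
  using (_≡_; refl; sym; trans; cong; subst; isEquivalence)
import Relation.Binary.PropositionalEquality as ≡

record Interval (n : ℕ) : Set where
  constructor interval
  field
    lo hi  : ℕ
    1≤lo   : 1 ≤ lo
    lo≤hi  : lo ≤ hi
    hi<n   : hi < n

open Interval public

interval-≡ : ∀ {n} {I J : Interval n} → lo I ≡ lo J → hi I ≡ hi J → I ≡ J
interval-≡ {_} {interval i j p q r} {interval _ _ p′ q′ r′} refl refl
  rewrite ≤-irrelevant p p′ | ≤-irrelevant q q′ | ≤-irrelevant r r′ = refl

infix 4 _⊑_ _⊑?_ _≟ᴵ_

_⊑_ : ∀ {n} → Rel (Interval n) 0ℓ
I ⊑ J = lo J ≤ lo I × hi I ≤ hi J

_⊑?_ : ∀ {n} → B.Decidable (_⊑_ {n})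
I ⊑? J = (lo J ≤? lo I) ×-dec (hi I ≤? hi J)

_≟ᴵ_ : ∀ {n} → B.Decidable (_≡_ {A = Interval n})
I ≟ᴵ J = map′ (λ (p , q) → interval-≡ p q) (λ { refl → refl , refl })
              ((lo I ≟ lo J) ×-dec (hi I ≟ hi J))

⊑-isPartialOrder : ∀ {n} → IsPartialOrder (_≡_ {A = Interval n}) _⊑_
⊑-isPartialOrder = record
  { isPreorder = record
    { isEquivalence = isEquivalence
    ; reflexive     = λ { refl → ≤-refl , ≤-refl }
    ; trans         = λ (p , q) (p′ , q′) → ≤-trans p′ p , ≤-trans q q′
    }
  ; antisym = λ (p , q) (p′ , q′) → interval-≡ (≤-antisym p′ p) (≤-antisym q q′)
  }

-- The type A root poset A^{n-1}: intervals in {1, …, n-1}, so the index is n, not n-1.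
𝔸 : ℕ → Poset 0ℓ 0ℓ 0ℓ
𝔸 n = record { isPartialOrder = ⊑-isPartialOrder {n} }

𝔹 : ℕ → Poset 0ℓ 0ℓ 0ℓ
𝔹 m = On.poset {B = Σ[ I ∈ Interval (2 * m) ] lo I + hi I ≤ 2 * m} (𝔸 (2 * m)) proj₁

-- Membership must be decidable: constructively, undecidable subsets of a finite
-- set cannot be counted.
record Antichain (P : Poset 0ℓ 0ℓ 0ℓ) : Set₁ where
  private module P = Poset P
  field
    mem       : Pred P.Carrier 0ℓ
    mem?      : Decidable mem
    resp      : mem Respects P._≈_
    antichain : ∀ {x y} → mem x → mem y → x P.≤ y → x P.≈ y

open Antichain public

𝒜 : Poset 0ℓ 0ℓ 0ℓ → Setoid (lsuc 0ℓ) 0ℓ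
𝒜 P = On.setoid {B = Antichain P} (≐-setoid (Poset.Carrier P) 0ℓ) mem

Σ-dec : ∀ {P : Set} {Q : P → Set} → Irrelevant P → Dec P → (∀ p → Dec (Q p)) → Dec (Σ P Q)
Σ-dec irr (no ¬p) Q? = no (¬p ∘ proj₁)
Σ-dec {Q = Q} irr (yes p) Q? =
  map′ (p ,_) (λ (p′ , q) → subst Q (irr p′ p) q) (Q? p)

anyInterval? : ∀ {n} {Q : Pred (Interval n) 0ℓ} → Decidable Q → Dec (∃ Q)
anyInterval? {n} {Q} Q? = map′
  (λ (j , _ , i , _ , p , q , r , x) → interval i j p q r , x)
  (λ (interval i j p q r , x) → j , r , i , s≤s q , p , q , r , x)
  (anyUpTo? (λ j → anyUpTo? (λ i →
    Σ-dec ≤-irrelevant (1 ≤? i) λ p →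
    Σ-dec ≤-irrelevant (i ≤? j) λ q →
    Σ-dec ≤-irrelevant (j <? n) λ r →
    Q? (interval i j p q r)) (suc j)) n)

module _ (P : Poset 0ℓ 0ℓ 0ℓ) where
  private module P = Poset P

  ↓ : Pred P.Carrier 0ℓ → Pred P.Carrier 0ℓ
  ↓ S x = ∃[ y ] (S y × x P.≤ y)

  Minimal : Pred P.Carrier 0ℓ → Pred P.Carrier 0ℓ
  Minimal S x = S x × (∀ {y} → S y → y P.≤ x → y P.≈ x)

↓? : ∀ {n} {S : Pred (Interval n) 0ℓ} → Decidable S → Decidable (↓ (𝔸 n) S)
↓? S? I = anyInterval? (λ J → S? J ×-dec (I ⊑? J))

minimal? : ∀ {n} {S : Pred (Interval n) 0ℓ} → Decidable S → Decidable (Minimal (𝔸 n) S)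
minimal? S? I = S? I ×-dec map′
  (λ ¬below {J} s le → decidable-stable (J ≟ᴵ I) (λ ne → ¬below (J , s , le , ne)))
  (λ min (J , s , le , ne) → ne (min s le))
  (¬? (anyInterval? (λ J → S? J ×-dec ((J ⊑? I) ×-dec ¬? (J ≟ᴵ I)))))

ρ : ∀ {n} → Antichain (𝔸 n) → Antichain (𝔸 n)
ρ {n} A = record
  { mem       = Minimal (𝔸 n) (∁ (↓ (𝔸 n) (mem A)))
  ; mem?      = minimal? (∁? (↓? (mem? A)))
  ; resp      = λ { refl x → x }
  ; antichain = λ (s , _) (_ , min) le → min s le
  }

module _ {n : ℕ} (A : Antichain (𝔸 n)) where

  IsLo IsHi : Pred ℕ 0ℓ
  IsLo i = ∃[ I ] (mem A I × lo I ≡ i)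
  IsHi j = ∃[ I ] (mem A I × hi I ≡ j)

  isLo? : Decidable IsLo
  isLo? i = anyInterval? (λ I → mem? A I ×-dec (lo I ≟ i))

  isHi? : Decidable IsHi
  isHi? j = anyInterval? (λ I → mem? A I ×-dec (hi I ≟ j))

  -- i′₁ < i′₂ < … and j′₁ < j′₂ < …, filtered from the list 1, …, n-1.
  los′ his′ : List ℕ
  los′ = filter (∁? isHi?) (applyUpTo suc (n ∸ 1))
  his′ = filter (∁? isLo?) (applyUpTo suc (n ∸ 1))

  los′-increasing : AllPairs _<_ los′
  los′-increasing = AllPairs.filter⁺ (∁? isHi?) (AllPairs.applyUpTo⁺₁ suc (n ∸ 1) (λ i<j _ → s≤s i<j))

  his′-increasing : AllPairs _<_ his′
  his′-increasing = AllPairs.filter⁺ (∁? isLo?) (AllPairs.applyUpTo⁺₁ suc (n ∸ 1) (λ i<j _ → s≤s i<j))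

∈-zip : ∀ {a b : ℕ} (xs ys : List ℕ) → (a , b) ∈ zip xs ys → a ∈ xs × b ∈ ys
∈-zip (x ∷ xs) (y ∷ ys) (here refl) = here refl , here refl
∈-zip (x ∷ xs) (y ∷ ys) (there p)   = let q , r = ∈-zip xs ys p in there q , there r

zip-increasing : ∀ {xs ys a b c d} → AllPairs _<_ xs → AllPairs _<_ ys →
                 (a , b) ∈ zip xs ys → (c , d) ∈ zip xs ys →
                 c ≤ a → b ≤ d → a ≡ c × b ≡ d
zip-increasing {x ∷ xs} {y ∷ ys} _ _ (here refl) (here refl) _ _ = refl , refl
zip-increasing {x ∷ xs} {y ∷ ys} (x< ∷ _) _ (here refl) (there q) c≤a _ =
  contradiction c≤a (<⇒≱ (All.lookup x< (proj₁ (∈-zip xs ys q))))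
zip-increasing {x ∷ xs} {y ∷ ys} _ (y< ∷ _) (there p) (here refl) _ b≤d =
  contradiction b≤d (<⇒≱ (All.lookup y< (proj₂ (∈-zip xs ys p))))
zip-increasing {x ∷ xs} {y ∷ ys} (_ ∷ xs<) (_ ∷ ys<) (there p) (there q) c≤a b≤d =
  zip-increasing xs< ys< p q c≤a b≤d

-- For an antichain A both lists have length n-1-|A| and i′ₗ ≤ j′ₗ for every l,
-- so neither zip nor the restriction to intervals discards anything.
LK : ∀ {n} → Antichain (𝔸 n) → Antichain (𝔸 n)
LK {n} A = record
  { mem       = λ I → (lo I , hi I) ∈ zip (los′ A) (his′ A)
  ; mem?      = λ I → (lo I , hi I) ∈? zip (los′ A) (his′ A)
  ; resp      = λ { refl x → x }
  ; antichain = λ p q (lo≤ , ≤hi) →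
      let e , f = zip-increasing (los′-increasing A) (his′-increasing A) p q lo≤ ≤hi
      in interval-≡ e f
  }
  where open DecMembership (≡-dec _≟_ _≟_) using (_∈?_)

reflect : ∀ {n} → Interval n → Interval n
reflect {n} (interval i j p q r) = record
  { lo    = n ∸ j
  ; hi    = n ∸ i
  ; 1≤lo  = m<n⇒0<n∸m r
  ; lo≤hi = ∸-monoʳ-≤ n q
  ; hi<n  = ∸-monoʳ-< p (≤-trans q (<⇒≤ r))
  }

reflect-involutive : ∀ {n} (I : Interval n) → reflect (reflect I) ≡ I
reflect-involutive I = interval-≡
  (m∸[m∸n]≡n (≤-trans (lo≤hi I) (<⇒≤ (hi<n I)))) (m∸[m∸n]≡n (<⇒≤ (hi<n I)))

reflect-mono : ∀ {n} {I J : Interval n} → I ⊑ J → reflect I ⊑ reflect J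
reflect-mono {n} (p , q) = ∸-monoʳ-≤ n q , ∸-monoʳ-≤ n p

reflect-injective : ∀ {n} {I J : Interval n} → reflect I ≡ reflect J → I ≡ J
reflect-injective {I = I} {J} e =
  trans (sym (reflect-involutive I)) (trans (cong reflect e) (reflect-involutive J))

reflect-lo : ∀ {n} (J : Interval n) → lo (reflect J) + hi (reflect J) ≤ n → lo (reflect J) ≤ lo J
reflect-lo {n} J t = subst (n ∸ hi J ≤_) (m∸[m∸n]≡n (≤-trans (lo≤hi J) (<⇒≤ (hi<n J))))
                           (m+n≤o⇒m≤o∸n (n ∸ hi J) t)

⊑-reflect : ∀ {n} {I J : Interval n} → lo I + hi I ≤ n →
            lo (reflect J) + hi (reflect J) ≤ n → I ⊑ J → I ⊑ reflect J
⊑-reflect {n} {I} {J} s t (p , q) =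
  ≤-trans n∸b≤a p ,
  ≤-trans (m+n≤o⇒m≤o∸n (hi I) (subst (_≤ n) (+-comm (lo I) (hi I)) s)) (∸-monoʳ-≤ n p)
  where
  n∸b≤a : n ∸ hi J ≤ lo J
  n∸b≤a = reflect-lo J t

reflect-≡ : ∀ {n} {I J : Interval n} → lo (reflect J) + hi (reflect J) ≤ n →
            I ⊑ J → I ≡ reflect J → I ≡ J
reflect-≡ {n} {I} {J} t (p , q) refl = interval-≡ (≤-antisym n∸b≤a p) (≤-antisym q b≤n∸a)
  where
  n∸b≤a : n ∸ hi J ≤ lo J
  n∸b≤a = reflect-lo J t
  b≤n∸a : hi J ≤ n ∸ lo J
  b≤n∸a = subst (_≤ n ∸ lo J) (m∸[m∸n]≡n (<⇒≤ (hi<n J))) (∸-monoʳ-≤ n p)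

module _ (m : ℕ) (A : Antichain (𝔹 m)) where

  -- "I ∈ A" for an interval I not known in advance to lie in 𝔹 m.
  mem𝔹 : Pred (Interval (2 * m)) 0ℓ
  mem𝔹 I = ∃[ p ] mem {𝔹 m} A (I , p)

  mem𝔹? : Decidable mem𝔹
  mem𝔹? I = Σ-dec ≤-irrelevant (lo I + hi I ≤? 2 * m) (λ p → mem? {𝔹 m} A (I , p))

  mem𝔹-antichain : ∀ {I J} → mem𝔹 I → mem𝔹 J → I ⊑ J → I ≡ J
  mem𝔹-antichain (_ , x) (_ , y) le = antichain {𝔹 m} A x y le

  mixed : ∀ {I J} → mem𝔹 I → mem𝔹 (reflect J) → I ⊑ J → I ≡ J
  mixed {I} {J} x@(s , _) y@(t , _) le =
    reflect-≡ {I = I} {J} t le (mem𝔹-antichain x y (⊑-reflect {I = I} {J} s t le))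

-- The antichain Â of A: all [i,j] with [i,j] ∈ A or [2m-j,2m-i] ∈ A. It is invariant
-- under reflect, and hat is a bijection onto the reflect-invariant antichains.
hat : ∀ m → Antichain (𝔹 m) → Antichain (𝔸 (2 * m))
hat m A = record
  { mem       = λ I → mem𝔹 m A I ⊎ mem𝔹 m A (reflect I)
  ; mem?      = λ I → mem𝔹? m A I ⊎-dec mem𝔹? m A (reflect I)
  ; resp      = λ { refl x → x }
  ; antichain = anti
  }
  where
  anti : ∀ {I J} → mem𝔹 m A I ⊎ mem𝔹 m A (reflect I) → mem𝔹 m A J ⊎ mem𝔹 m A (reflect J) →
         I ⊑ J → I ≡ J
  anti (inj₁ x) (inj₁ y) le = mem𝔹-antichain m A x y le
  anti (inj₁ x) (inj₂ y) le = mixed m A x y le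
  anti {I} {J} (inj₂ x) (inj₁ y) le = reflect-injective (mixed m A x
    (subst (mem𝔹 m A) (sym (reflect-involutive J)) y) (reflect-mono {I = I} {J} le))
  anti {I} {J} (inj₂ x) (inj₂ y) le =
    reflect-injective (mem𝔹-antichain m A x y (reflect-mono {I = I} {J} le))

-- {A ∈ 𝒜(𝔹 m) : LK (ρ A) = A}, with 𝒜(𝔹 m) embedded in 𝒜(𝔸 (2m)) by hat.
LKρ-Fixed : ℕ → Setoid (lsuc 0ℓ) 0ℓ
LKρ-Fixed m = On.setoid {B = Σ[ A ∈ Antichain (𝔹 m) ] LK (ρ (hat m A)) ≈ hat m A} (𝒜 (𝔹 m)) proj₁
  where open Setoid (𝒜 (𝔸 (2 * m))) using (_≈_)

HasCardinality : ∀ {a ℓ} → Setoid a ℓ → ℕ → Set (a ⊔ ℓ)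
HasCardinality S k = Inverse S (≡.setoid (Fin k))

{-# OPTIONS --safe #-}

-- Read an antichain A of A^{n-1} as a path of n steps, where step k rises if k+1 is a left end
-- of A and falls if k is a right end. The height at k is then the number of intervals of A
-- containing k. The left ends of ρ(A) are the a such that a+1 is a left end of A or a is
-- uncovered, and dually for the right ends, so LK(ρ(A)) = A says exactly that every step changes
-- the height by ±1, except for level steps at height 0. Reflection reverses the path. A symmetric
-- path of 2m steps is determined by its first m steps, and at each of these there are two choices:
-- up or down at positive height, up or level at height 0.

module Submission where

open import Level using (0ℓ)
open import Data.Bool using (Bool; true; false; not; if_then_else_; _∧_)
import Data.Bool.Properties as Bool
open import Data.Bool.Properties using (¬-not; not-injective)
open import Data.Nat using (ℕ; >-nonZero; zero; suc; pred; _+_; _*_; _∸_; _≤_; _<_; _^_; _≟_; _≤?_; _<?_; z≤n; s≤s)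
open import Data.Nat.Properties
open import Data.Fin using (Fin; zero; suc; toℕ; fromℕ<; combine; funToFin; finToFun)
open import Data.Fin.Properties using (2↔Bool; toℕ<n; toℕ-fromℕ<; fromℕ<-toℕ; funToFin-finToFin; finToFun-funToFin)
open import Data.List using (List; _∷_; applyUpTo; filter; zip)
open import Data.List.Properties using (filter-accept)
open import Data.List.Membership.Propositional using (_∈_)
open import Data.List.Relation.Unary.Any using (here; there)
open import Data.Product using (_×_; _,_; proj₁; proj₂; ∃-syntax)
open import Data.Sum using (_⊎_; inj₁; inj₂; [_,_]′)
open import Function using (_∘_; flip)
open import Function.Bundles using (Inverse; Injection; mk⇔)
open import Function.Properties.Inverse using (↔-sym; Inverse⇒Injection)
open import Relation.Nullary using (Dec; yes; no; ¬_; does; contradiction)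
open import Relation.Nullary.Decidable using (dec-true; dec-false; does-⇔; decidable-stable; _×-dec_)
open import Relation.Unary using (Pred; Decidable)
open import Relation.Binary using (Setoid; tri<; tri≈; tri>)
open import Relation.Binary.PropositionalEquality hiding (resp)
open import Defs

-- Decisions and truncated subtraction

does⇒ : {P : Set} (P? : Dec P) → does P? ≡ true → P
does⇒ (yes p) _ = p

does⇒¬ : {P : Set} (P? : Dec P) → does P? ≡ false → ¬ P
does⇒¬ (no ¬p) _ = ¬p

suc[n∸[1+k]]≡n∸k : ∀ {n k} → k < n → suc (n ∸ suc k) ≡ n ∸ k
suc[n∸[1+k]]≡n∸k {suc n} {zero}  _         = refl
suc[n∸[1+k]]≡n∸k {suc n} {suc k} (s≤s k<n) = suc[n∸[1+k]]≡n∸k k<n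

n∸[1+[n∸[1+k]]]≡k : ∀ {n k} → k < n → n ∸ suc (n ∸ suc k) ≡ k
n∸[1+[n∸[1+k]]]≡k {n} k<n = trans (cong (n ∸_) (suc[n∸[1+k]]≡n∸k k<n)) (m∸[m∸n]≡n (<⇒≤ k<n))

n∸[1+k]<n : ∀ {n k} → k < n → n ∸ suc k < n
n∸[1+k]<n {k = k} k<n = ≤-trans (≤-reflexive (suc[n∸[1+k]]≡n∸k k<n)) (m∸n≤m _ k)

m≤2m∸[1+k] : ∀ {m k} → k < m → m ≤ 2 * m ∸ suc k
m≤2m∸[1+k] {m} k<m = m+n≤o⇒m≤o∸n m (+-monoʳ-≤ m (≤-trans k<m (m≤m+n m 0)))

2m∸[1+k]<m : ∀ {m k} → m ≤ k → k < 2 * m → 2 * m ∸ suc k < m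
2m∸[1+k]<m {m} {k} m≤k k<2m = subst (2 * m ∸ suc k <_)
  (trans (m+n∸m≡n m (m + 0)) (+-identityʳ m)) (∸-monoʳ-< (s≤s m≤k) k<2m)

-- Counting

count : (ℕ → Bool) → ℕ → ℕ
count p zero    = 0
count p (suc n) = if p n then suc (count p n) else count p n

module _ {p : ℕ → Bool} where

  count-true : ∀ {n} → p n ≡ true → count p (suc n) ≡ suc (count p n)
  count-true {n} e rewrite e = refl

  count-false : ∀ {n} → p n ≡ false → count p (suc n) ≡ count p n
  count-false {n} e rewrite e = refl

  count-≤-suc : ∀ n → count p n ≤ count p (suc n)
  count-≤-suc n with p n
  ... | true  = n≤1+n _
  ... | false = ≤-refl

  count-mono : ∀ {m n} → m ≤ n → count p m ≤ count p n
  count-mono {m} {zero}  z≤n = ≤-refl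
  count-mono {m} {suc n} m≤ with m≤n⇒m<n∨m≡n m≤
  ... | inj₁ (s≤s m≤n) = ≤-trans (count-mono m≤n) (count-≤-suc n)
  ... | inj₂ refl      = ≤-refl

  count-strict : ∀ {m n} → p m ≡ true → m < n → count p m < count p n
  count-strict e m<n = ≤-trans (≤-reflexive (sym (count-true e))) (count-mono m<n)

  count-injective : ∀ {m n} → p m ≡ true → p n ≡ true → count p m ≡ count p n → m ≡ n
  count-injective {m} {n} pm pn e with <-cmp m n
  ... | tri< m<n _ _ = contradiction e (<⇒≢ (count-strict pm m<n))
  ... | tri≈ _ m≡n _ = m≡n
  ... | tri> _ _ n<m = contradiction (sym e) (<⇒≢ (count-strict pn n<m))

  count-jump : ∀ {n} → count p n < count p (suc n) → p n ≡ true
  count-jump {n} lt with p n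
  ... | true  = refl
  ... | false = contradiction lt (<-irrefl refl)

  count-attains : ∀ {r} n → r < count p n → ∃[ k ] (k < n × p k ≡ true × count p k ≡ r)
  count-attains {r} (suc n) lt with r <? count p n
  ... | yes r< = let k , k<n , rest = count-attains n r< in k , m<n⇒m<1+n k<n , rest
  ... | no  r≮ = n , ≤-refl , pn , ≤-antisym (≮⇒≥ r≮) (≤-pred (≤-trans lt (≤-reflexive (count-true pn))))
    where
    pn : p n ≡ true
    pn = count-jump (≤-<-trans (≮⇒≥ r≮) lt)

  count-not : ∀ n → count (not ∘ p) n + count p n ≡ n
  count-not zero = refl
  count-not (suc n) with p n
  ... | true  = trans (+-suc _ _) (cong suc (count-not n))
  ... | false = cong suc (count-not n)

count-cong : ∀ {p q : ℕ → Bool} n → (∀ {k} → k < n → p k ≡ q k) → count p n ≡ count q n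
count-cong zero    eq = refl
count-cong (suc n) eq rewrite eq {n} ≤-refl | count-cong n (λ k<n → eq (m<n⇒m<1+n k<n)) = refl

count-front-true : ∀ {p} n → p 0 ≡ true → count p (suc n) ≡ suc (count (p ∘ suc) n)
count-front-true zero e rewrite e = refl
count-front-true {p} (suc n) e with p (suc n)
... | true  = cong suc (count-front-true n e)
... | false = count-front-true n e

count-front-false : ∀ {p} n → p 0 ≡ false → count p (suc n) ≡ count (p ∘ suc) n
count-front-false zero e rewrite e = refl
count-front-false {p} (suc n) e with p (suc n)
... | true  = cong suc (count-front-false n e)
... | false = count-front-false n e

-- A matching that preserves strict order is injective. In the induction the partner of the last
-- true position becomes the new bound on the side of `q`, because all earlier partners lie strictly
-- below it.
count-matching : ∀ {p q} (R : ℕ → ℕ → Set) →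
  (∀ {x x′ y y′} → R x y → R x′ y′ → x < x′ → y < y′) →
  ∀ m {n} → (∀ {x} → x < m → p x ≡ true → ∃[ y ] (y < n × q y ≡ true × R x y)) →
  count p m ≤ count q n
count-matching R R-mono zero match = z≤n
count-matching {p} {q} R R-mono (suc m) match with p m in pm
... | false = count-matching R R-mono m (λ x<m → match (m<n⇒m<1+n x<m))
... | true  =
  let y , y<n , qy , r = match ≤-refl pm in
  ≤-<-trans
    (count-matching R R-mono m λ x<m px →
      let y′ , _ , qy′ , r′ = match (m<n⇒m<1+n x<m) px in y′ , R-mono r′ r x<m , qy′ , r′)
    (count-strict qy y<n)

count-reverse : ∀ {p q} n → (∀ {k} → k < n → p (n ∸ suc k) ≡ q k) →
                ∀ k → k ≤ n → count p (n ∸ k) + count q k ≡ count p n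
count-reverse n rev zero    _   = +-identityʳ _
count-reverse {p} {q} n rev (suc k) k<n = begin
  count p (n ∸ suc k) + count q (suc k)    ≡⟨ shift (rev k<n) ⟩
  count p (suc (n ∸ suc k)) + count q k    ≡⟨ cong (λ i → count p i + count q k) (suc[n∸[1+k]]≡n∸k k<n) ⟩
  count p (n ∸ k) + count q k              ≡⟨ count-reverse n rev k (<⇒≤ k<n) ⟩
  count p n                                ∎
  where
  open ≡-Reasoning
  shift : ∀ {i} → p i ≡ q k → count p i + count q (suc k) ≡ count p (suc i) + count q k
  shift {i} e rewrite e with q k
  ... | true  = +-suc _ _
  ... | false = refl

-- Lists

-- Positions turn membership in a `zip` into a shared index, which `Nth-filter⁻` and `Nth-filter⁺`
-- express as a rank.
data Nth {A : Set} : List A → ℕ → A → Set where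
  hd : ∀ {x xs} → Nth (x ∷ xs) 0 x
  tl : ∀ {x xs k y} → Nth xs k y → Nth (x ∷ xs) (suc k) y

∈-zip⇒Nth : ∀ {xs ys : List ℕ} {x y} → (x , y) ∈ zip xs ys → ∃[ k ] (Nth xs k x × Nth ys k y)
∈-zip⇒Nth {_ ∷ _} {_ ∷ _} (here refl) = 0 , hd , hd
∈-zip⇒Nth {_ ∷ _} {_ ∷ _} (there h)   = let k , p , q = ∈-zip⇒Nth h in suc k , tl p , tl q

Nth⇒∈-zip : ∀ {xs ys : List ℕ} {k x y} → Nth xs k x → Nth ys k y → (x , y) ∈ zip xs ys
Nth⇒∈-zip hd     hd     = here refl
Nth⇒∈-zip (tl p) (tl q) = there (Nth⇒∈-zip p q)

module _ {P : Pred ℕ 0ℓ} (P? : Decidable P) where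

  -- The position of an entry in the filtered list is the number of accepted entries before it.
  Nth-filter⁻ : ∀ f N {k x} → Nth (filter P? (applyUpTo f N)) k x →
                ∃[ a ] (a < N × x ≡ f a × P x × count (does ∘ P? ∘ f) a ≡ k)
  Nth-filter⁻ f (suc N) h with P? (f 0) in eq
  Nth-filter⁻ f (suc N) hd | yes p = 0 , s≤s z≤n , refl , p , refl
  Nth-filter⁻ f (suc N) (tl h) | yes _ =
    let a , a<N , e , p , c = Nth-filter⁻ (f ∘ suc) N h
    in suc a , s≤s a<N , e , p , trans (count-front-true a (cong does eq)) (cong suc c)
  Nth-filter⁻ f (suc N) h | no _ =
    let a , a<N , e , p , c = Nth-filter⁻ (f ∘ suc) N h
    in suc a , s≤s a<N , e , p , trans (count-front-false a (cong does eq)) c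

  Nth-filter⁺ : ∀ f N {a} → a < N → P (f a) →
                Nth (filter P? (applyUpTo f N)) (count (does ∘ P? ∘ f) a) (f a)
  Nth-filter⁺ f (suc N) {zero} _ p rewrite filter-accept P? {xs = applyUpTo (f ∘ suc) N} p = hd
  Nth-filter⁺ f (suc N) {suc a} (s≤s a<N) p with P? (f 0)
  ... | yes q rewrite count-front-true {does ∘ P? ∘ f} a (dec-true (P? (f 0)) q) =
    tl (Nth-filter⁺ (f ∘ suc) N a<N p)
  ... | no ¬q rewrite count-front-false {does ∘ P? ∘ f} a (dec-false (P? (f 0)) ¬q) =
    Nth-filter⁺ (f ∘ suc) N a<N p

-- Antichains as lattice paths

module Path {n : ℕ} (X : Antichain (𝔸 n)) where

  up down : ℕ → Bool
  up k   = does (isLo? X (suc k))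
  down k = does (isHi? X k)

  -- Because of the shift in `up`, `ups k` counts the left ends at most `k`, whereas `downs k`
  -- counts the right ends strictly below `k`. An interval containing `k` is thus counted by the
  -- first and not by the second.
  ups downs : ℕ → ℕ
  ups   = count up
  downs = count down

  mem-hi-mono-< : ∀ {I J} → mem X I → mem X J → lo I < lo J → hi I < hi J
  mem-hi-mono-< x y lt = ≰⇒> λ hJ≤hI →
    <⇒≢ lt (sym (cong lo (antichain X y x (<⇒≤ lt , hJ≤hI))))

  mem-lo-mono-< : ∀ {I J} → mem X I → mem X J → hi I < hi J → lo I < lo J
  mem-lo-mono-< x y lt = ≰⇒> λ lJ≤lI →
    <⇒≢ lt (cong hi (antichain X x y (lJ≤lI , <⇒≤ lt)))

  up-mem : ∀ {I} → mem X I → up (pred (lo I)) ≡ true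
  up-mem {interval (suc i) j p q r} x = dec-true (isLo? X (suc i)) (_ , x , refl)

  down-mem : ∀ {I} → mem X I → down (hi I) ≡ true
  down-mem {I} x = dec-true (isHi? X (hi I)) (_ , x , refl)

  up⇒mem : ∀ {k} → up k ≡ true → ∃[ I ] (mem X I × lo I ≡ suc k)
  up⇒mem {k} = does⇒ (isLo? X (suc k))

  down⇒mem : ∀ {k} → down k ≡ true → ∃[ I ] (mem X I × hi I ≡ k)
  down⇒mem {k} = does⇒ (isHi? X k)

  Joined : ℕ → ℕ → Set
  Joined a b = ∃[ J ] (mem X J × lo J ≡ suc a × hi J ≡ b)

  joined-mono-< : ∀ {a a′ b b′} → Joined a b → Joined a′ b′ → a < a′ → b < b′
  joined-mono-< (_ , x , refl , refl) (_ , y , refl , refl) lt = mem-hi-mono-< x y (s≤s lt)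

  joined-cancel-< : ∀ {b b′ a a′} → Joined a b → Joined a′ b′ → b < b′ → a < a′
  joined-cancel-< (_ , x , refl , refl) (_ , y , refl , refl) lt = ≤-pred (mem-lo-mono-< x y lt)

  -- Left ends and right ends of an antichain come in the same order. So the members that start
  -- before `I` are those that end before `I`, and `Joined` matches their ends in both directions.
  mem-rank : ∀ {I} → mem X I → ups (pred (lo I)) ≡ downs (hi I)
  mem-rank {I@(interval (suc i) j p q r)} x = ≤-antisym
    (count-matching Joined joined-mono-<
      i λ a<i ua → let J , y , e = up⇒mem ua in
        hi J , mem-hi-mono-< y x (subst (_< suc i) (sym e) (s≤s a<i)) , down-mem y , J , y , e , refl)
    (count-matching (flip Joined) joined-cancel-<
      j λ b<j db → let J , y , e = down⇒mem db in
        pred (lo J) , ≤-pred (subst (_< suc i) (lo≡ J) (mem-lo-mono-< y x (subst (_< j) (sym e) b<j))) ,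
        up-mem y , J , y , lo≡ J , e)
    where
    lo≡ : (J : Interval n) → lo J ≡ suc (pred (lo J))
    lo≡ (interval (suc _) _ _ _ _) = refl

  -- The member starting at `lo I` has a right end of the same rank as `hi I`, hence ends there. An
  -- antichain is therefore recovered from its path by pairing ends of equal rank.
  mem⇐ : ∀ {I} → up (pred (lo I)) ≡ true → down (hi I) ≡ true → ups (pred (lo I)) ≡ downs (hi I) → mem X I
  mem⇐ {I@(interval (suc i) j p q r)} ui dj e with up⇒mem ui
  ... | J , y , refl = subst (mem X) (interval-≡ refl
      (count-injective (down-mem y) dj (trans (sym (mem-rank y)) e))) y

  down-zero : down 0 ≡ false
  down-zero = dec-false (isHi? X 0) λ { (interval _ _ p q _ , _ , refl) → contradiction (≤-trans p q) λ () }

  up-last : ∀ {k} → n ≤ suc k → up k ≡ false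
  up-last {k} n≤ = dec-false (isLo? X (suc k))
    λ { (interval _ _ p q r , _ , refl) → contradiction (≤-trans r (≤-trans n≤ q)) (<-irrefl refl) }

  -- An interval ending at or before `k` also starts at or before `k`. This is stronger by one index
  -- than nonnegative height.
  downs≤ups : ∀ k → downs (suc k) ≤ ups k
  downs≤ups k = count-matching (flip Joined) joined-cancel-<
    (suc k) match
    where
    match : ∀ {b} → b < suc k → down b ≡ true →
            ∃[ a ] (a < k × up a ≡ true × Joined a b)
    match b<1+k db with down⇒mem db
    ... | J@(interval (suc a) j p q r) , y , refl =
      a , ≤-trans q (≤-pred b<1+k) , up-mem y , J , y , refl , refl

  downs≤ups′ : ∀ k → downs k ≤ ups k
  downs≤ups′ k = ≤-trans (count-≤-suc k) (downs≤ups k)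

  ups≤downs : ups n ≤ downs n
  ups≤downs = count-matching Joined joined-mono-<
    n λ _ ua → let J , y , e = up⇒mem ua in hi J , hi<n J , down-mem y , J , y , e , refl

  ups≡downs : ups n ≡ downs n
  ups≡downs = ≤-antisym ups≤downs (downs≤ups′ n)

  -- Rowmotion in terms of the path

  ↓⇒ : ∀ {I} → ↓ (𝔸 n) (mem X) I → downs (hi I) < ups (lo I)
  ↓⇒ {I} (J@(interval (suc i) _ _ _ _) , y , lJ≤ , ≤hJ) = begin-strict
    downs (hi I)     ≤⟨ count-mono ≤hJ ⟩
    downs (hi J)     ≡⟨ mem-rank y ⟨
    ups i            <⟨ count-strict (up-mem y) lJ≤ ⟩
    ups (lo I)       ∎
    where open ≤-Reasoning

  -- If no member contains `I`, every member that has started by `lo I` has ended before `hi I`, so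
  -- the left ends up to `lo I` match into the right ends below `hi I`.
  ⇒↓ : ∀ {I} → downs (hi I) < ups (lo I) → ↓ (𝔸 n) (mem X) I
  ⇒↓ {I} lt = decidable-stable (↓? (mem? X) I) λ ¬↓ → <⇒≱ lt
    (count-matching Joined joined-mono-<
      (lo I) λ a< ua → let J , y , e = up⇒mem ua in
        hi J , ≰⇒> (λ hI≤ → ¬↓ (J , y , subst (_≤ lo I) (sym e) a< , hI≤)) , down-mem y , J , y , e , refl)

  ρ-above : ∀ I → mem (ρ X) I → ups (lo I) ≤ downs (hi I)
  ρ-above I (¬↓ , _) = ≮⇒≥ (¬↓ ∘ ⇒↓ {I})

  ρ-below : ∀ I J → mem (ρ X) I → J ⊑ I → ¬ J ≡ I → downs (hi J) < ups (lo J)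
  ρ-below I J (_ , min) J⊑I J≢I = ↓⇒ {J} (decidable-stable (↓? (mem? X) J) λ ¬↓J → J≢I (min ¬↓J J⊑I))

  -- An interval properly inside `I` lies in one that shortens `I` at a single end, so it is enough
  -- to test those against the ideal.
  ρ-mem : ∀ I → ups (lo I) ≤ downs (hi I) →
          (∀ {a} → lo I < a → a ≤ hi I → downs (hi I) < ups a) →
          (∀ {b} → b < hi I → lo I ≤ b → downs b < ups (lo I)) → mem (ρ X) I
  ρ-mem I above left right = (λ I↓ → <⇒≱ (↓⇒ {I} I↓) above) , λ {J} ¬J↓ (lI≤ , ≤hI) → minimal J ¬J↓ lI≤ ≤hI
    where
    minimal : ∀ J → ¬ ↓ (𝔸 n) (mem X) J → lo I ≤ lo J → hi J ≤ hi I → J ≡ I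
    minimal J ¬J↓ lI≤ ≤hI with m≤n⇒m<n∨m≡n lI≤ | m≤n⇒m<n∨m≡n ≤hI
    ... | inj₁ lt | _       = contradiction
      (⇒↓ {J} (≤-<-trans (count-mono ≤hI) (left lt (≤-trans (lo≤hi J) ≤hI)))) ¬J↓
    ... | inj₂ e  | inj₁ lt = contradiction
      (⇒↓ {J} (<-≤-trans (right lt (≤-trans lI≤ (lo≤hi J))) (count-mono lI≤))) ¬J↓
    ... | inj₂ e  | inj₂ e′ = interval-≡ (sym e) e′

  ρ-singleton : ∀ {a} (1≤a : 1 ≤ a) (a<n : a < n) → ups a ≤ downs a → mem (ρ X) (interval a a 1≤a ≤-refl a<n)
  ρ-singleton _ _ le = ρ-mem _ le
    (λ lt le → contradiction lt (≤⇒≯ le)) (λ lt le → contradiction lt (≤⇒≯ le))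

  -- If `[a,b]` is minimal outside the ideal and `a < b`, then `[a+1,b]` is in the ideal. Hence
  -- `ups a ≤ downs b < ups (a+1)`, and step `a` rises.
  isLo-ρ⇒ : ∀ {a} → IsLo (ρ X) a → up a ≡ true ⊎ ups a ≤ downs a
  isLo-ρ⇒ (I@(interval a b p q r) , x , refl) with m≤n⇒m<n∨m≡n q
  ... | inj₂ refl = inj₂ (ρ-above I x)
  ... | inj₁ a<b  = inj₁ (count-jump {up} (≤-<-trans (ρ-above I x)
    (ρ-below I (interval (suc a) b (s≤s z≤n) a<b r) x (n≤1+n a , ≤-refl) (λ e → 1+n≢n (cong lo e)))))

  isHi-ρ⇒ : ∀ {b} → IsHi (ρ X) (suc b) → down b ≡ true ⊎ ups (suc b) ≤ downs (suc b)
  isHi-ρ⇒ (I@(interval a (suc b) p q r) , x , refl) with m≤n⇒m<n∨m≡n q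
  ... | inj₂ refl = inj₂ (ρ-above I x)
  ... | inj₁ a<b  = inj₁ (count-jump {down} (<-≤-trans
    (ρ-below I (interval a b p (≤-pred a<b) (<-trans ≤-refl r)) x (≤-refl , n≤1+n b) (λ e → 1+n≢n (sym (cong hi e))))
    (ρ-above I x)))

  isLo-ρ⇐ : ∀ {a} → 1 ≤ a → a < n → up a ≡ true ⊎ ups a ≤ downs a → IsLo (ρ X) a
  isLo-ρ⇐ 1≤a a<n (inj₂ le) = _ , ρ-singleton 1≤a a<n le , refl
  isLo-ρ⇐ {a} 1≤a a<n (inj₁ ua) with downs a <? ups a
  ... | no ≮ = _ , ρ-singleton 1≤a a<n (≮⇒≥ ≮) , refl
  ... | yes lt =
    -- The right end of rank `ups a - 1` belongs to the last member that starts at or before `a`. So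
    -- `b + 1` is the first point by which all these members have ended. It is below `n` because the
    -- member starting at `a + 1` ends after `b`.
    let e = sym (suc-pred (ups a) {{>-nonZero (≤-<-trans z≤n lt)}})
        r<total = ≤-trans (≤-reflexive (sym e)) (≤-trans (count-mono (<⇒≤ a<n)) ups≤downs)
        b , b<n , db , gb = count-attains n r<total
        g1+b : downs (suc b) ≡ ups a
        g1+b = trans (count-true {down} db) (trans (cong suc gb) (sym e))
        a<1+b : a < suc b
        a<1+b = ≰⇒> λ 1+b≤a → <⇒≱ lt (≤-trans (≤-reflexive (sym g1+b)) (count-mono 1+b≤a))
        1+b<n : suc b < n
        1+b<n = ≰⇒> λ n≤1+b → <⇒≱ (<-≤-trans (count-strict ua a<n) ups≤downs)
                  (≤-trans (count-mono n≤1+b) (≤-reflexive g1+b))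
    in interval a (suc b) 1≤a (<⇒≤ a<1+b) 1+b<n ,
       ρ-mem _ (≤-reflexive (sym g1+b))
         (λ a<a′ _ → ≤-<-trans (≤-reflexive g1+b) (count-strict ua a<a′))
         (λ b′≤b _ → ≤-<-trans (count-mono {down} (≤-pred b′≤b)) (subst (downs b <_) g1+b (count-strict {down} db ≤-refl))) ,
       refl

  isHi-ρ⇐ : ∀ {b} → suc b < n → down b ≡ true ⊎ ups (suc b) ≤ downs (suc b) → IsHi (ρ X) (suc b)
  isHi-ρ⇐ b<n (inj₂ le) = _ , ρ-singleton (s≤s z≤n) b<n le , refl
  isHi-ρ⇐ {b} b<n (inj₁ db) with downs (suc b) <? ups (suc b)
  ... | no ≮ = _ , ρ-singleton (s≤s z≤n) b<n (≮⇒≥ ≮) , refl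
  ... | yes lt with count-attains (suc b) lt
  ... | zero  , _ , _ , e = contradiction (trans e (count-true {down} db)) λ ()
  -- Rank `downs (b+1)` singles out the first member not ended by `b`. It starts at `a + 2`, so
  -- `[a+1,b+1]` just escapes it on the left.
  ... | suc a , a<b , ua , e =
    interval (suc a) (suc b) (s≤s z≤n) (<⇒≤ a<b) b<n ,
    ρ-mem _ (≤-reflexive e)
      (λ a<a′ _ → ≤-<-trans (≤-reflexive (sym e)) (count-strict ua a<a′))
      (λ b′≤b _ → ≤-<-trans (count-mono {down} (≤-pred b′≤b)) (<-≤-trans (count-strict {down} db ≤-refl) (≤-reflexive (sym e)))) ,
    refl

-- The Lalanne-Kreweras involution in terms of ranks

module _ {n : ℕ} (B : Antichain (𝔸 n)) where
  open Path B

  private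
    suc<⇒<∸1 : ∀ {m a} → suc a < m → a < m ∸ 1
    suc<⇒<∸1 {suc m} (s≤s lt) = lt

  -- The equation compares the rank of `lo I` among the points that are not right ends with the rank
  -- of `hi I` among those that are not left ends. The extra `suc` appears because `down`, unlike
  -- `up`, is not shifted.
  LK-mem⇒ : ∀ I → mem (LK B) I → ¬ IsHi B (lo I) × ¬ IsLo B (hi I) ×
            count (not ∘ down ∘ suc) (pred (lo I)) ≡ count (not ∘ up) (pred (hi I))
  LK-mem⇒ I x with ∈-zip⇒Nth x
  ... | k , p , q with Nth-filter⁻ _ suc (n ∸ 1) p | Nth-filter⁻ _ suc (n ∸ 1) q
  ... | a , _ , refl , ¬hi , ca | b , _ , refl , ¬lo , cb = ¬hi , ¬lo , trans ca (sym cb)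

  LK-mem⇐ : ∀ I → ¬ IsHi B (lo I) → ¬ IsLo B (hi I) →
            count (not ∘ down ∘ suc) (pred (lo I)) ≡ count (not ∘ up) (pred (hi I)) → mem (LK B) I
  LK-mem⇐ (interval (suc i) (suc j) p q r) ¬hi ¬lo e = Nth⇒∈-zip
    (Nth-filter⁺ _ suc (n ∸ 1) (suc<⇒<∸1 (≤-<-trans q r)) ¬hi)
    (subst (λ k → Nth (his′ B) k (suc j)) (sym e) (Nth-filter⁺ _ suc (n ∸ 1) (suc<⇒<∸1 r) ¬lo))

  isHi-LK⇒ : ∀ {b} → IsHi (LK B) b → ¬ IsLo B b
  isHi-LK⇒ (I , x , refl) = proj₁ (proj₂ (LK-mem⇒ I x))

  -- The two zipped lists are equally long since there are as many left ends as right ends, so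
  -- `b + 1` has a partner `a + 1`. If the partner were larger, more right ends than left ends would
  -- occur up to `b + 1`, against `downs≤ups`.
  isHi-LK⇐ : ∀ {b} → suc b < n → ¬ IsLo B (suc b) → IsHi (LK B) (suc b)
  isHi-LK⇐ {b} b<n@(s≤s {n = N} b<N) ¬lo =
    let a , a<N , da , e = count-attains N rank<
        a≤b = ≮⇒≥ λ b<a → <⇒≱ (excess {a} (count-mono {not ∘ down ∘ suc} b<a) e) (downs≤ups (suc b))
        I = interval (suc a) (suc b) (s≤s z≤n) (s≤s a≤b) b<n
    in I , LK-mem⇐ I (does⇒¬ (isHi? B (suc a)) (not-injective da)) ¬lo e , refl
    where
    ub : up b ≡ false
    ub = dec-false (isLo? B (suc b)) ¬lo
    nup ndown : ℕ → ℕ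
    nup   = count (not ∘ up)
    ndown = count (not ∘ down ∘ suc)
    nup-suc : nup (suc b) ≡ suc (nup b)
    nup-suc = count-true {not ∘ up} (cong not ub)
    ndown+downs : ∀ k → ndown k + downs (suc k) ≡ k
    ndown+downs k = trans (cong (ndown k +_) (count-front-false k down-zero)) (count-not {down ∘ suc} k)
    nup≡ndown : nup N ≡ ndown N
    nup≡ndown = +-cancelʳ-≡ (ups N) _ _ (begin
      nup N + ups N              ≡⟨ count-not {up} N ⟩
      N                          ≡⟨ ndown+downs N ⟨
      ndown N + downs (suc N)    ≡⟨ cong (ndown N +_) ups≡downs ⟨
      ndown N + ups (suc N)      ≡⟨ cong (ndown N +_) (count-false {up} (up-last ≤-refl)) ⟩
      ndown N + ups N            ∎)
      where open ≡-Reasoning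
    rank< : nup b < ndown N
    rank< = begin-strict
      nup b          <⟨ n<1+n _ ⟩
      suc (nup b)    ≡⟨ nup-suc ⟨
      nup (suc b)    ≤⟨ count-mono {not ∘ up} b<N ⟩
      nup N          ≡⟨ nup≡ndown ⟩
      ndown N        ∎
      where open ≤-Reasoning
    excess : ∀ {a} → ndown (suc b) ≤ ndown a → ndown a ≡ nup b → ups (suc b) < downs (suc (suc b))
    excess {a} le e = +-cancelˡ-< (nup b) _ _ (begin-strict
      nup b + ups (suc b)                     <⟨ n<1+n _ ⟩
      suc (nup b) + ups (suc b)               ≡⟨ cong (_+ ups (suc b)) nup-suc ⟨
      nup (suc b) + ups (suc b)               ≡⟨ count-not {up} (suc b) ⟩
      suc b                                   ≡⟨ ndown+downs (suc b) ⟨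
      ndown (suc b) + downs (suc (suc b))     ≤⟨ +-monoˡ-≤ _ (≤-trans le (≤-reflexive e)) ⟩
      nup b + downs (suc (suc b))             ∎)
      where open ≤-Reasoning

-- Fixed points as paths with restricted steps

data Step : Bool → Bool → ℕ → ℕ → Set where
  rise : ∀ {f g} → Step true false f g
  fall : ∀ {f g} → g < f → Step false true f g
  flat : ∀ {f g} → f ≡ g → Step false false f g

Steps : ℕ → (ℕ → Bool) → (ℕ → Bool) → Set
Steps n u d = ∀ {k} → k < n → Step (u k) (d k) (count u k) (count d k)

-- The hypotheses say that a fall occurs exactly when there is no rise and the height is not 0. They
-- exclude the level step at which one interval ends and the next begins, for which `Step` has no
-- constructor.
step : ∀ {u d f g} → (d ≡ true → u ≡ false × g < f) → (d ≡ false → u ≡ false → f ≡ g) → Step u d f g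
step {true}  {true}  t _ = contradiction (proj₁ (t refl)) λ ()
step {true}  {false} _ _ = rise
step {false} {true}  t _ = fall (proj₂ (t refl))
step {false} {false} _ f = flat (f refl refl)

module _ {n : ℕ} (X : Antichain (𝔸 n)) where
  open Path X
  private module ρX = Path (ρ X)
  open Setoid (𝒜 (𝔸 n)) using (_≈_)

  -- Comparing right ends is enough. Those of `LK (ρ X)` are the points that are not left ends of
  -- `ρ X`, that is, the covered points at which the path does not rise.
  fixed⇒steps : LK (ρ X) ≈ X → Steps n up down
  fixed⇒steps (LK⊆ , LK⊇) {zero} _ =
    step (λ t → contradiction (trans (sym t) down-zero) λ ()) (λ _ _ → refl)
  fixed⇒steps (LK⊆ , LK⊇) {suc k} k<n = step
    (λ t → let ¬lo = isHi-LK⇒ (ρ X) (isHi⊆ (does⇒ (isHi? X (suc k)) t)) in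
      ¬-not (λ u → ¬lo (isLo-ρ⇐ (s≤s z≤n) k<n (inj₁ u))) ,
      ≰⇒> (λ le → ¬lo (isLo-ρ⇐ (s≤s z≤n) k<n (inj₂ le))))
    (λ d u → ≤-antisym
      ([ (λ t → contradiction (trans (sym t) u) λ ()) , (λ le → le) ]′ (isLo-ρ⇒
        (decidable-stable (isLo? (ρ X) (suc k)) λ ¬lo →
          does⇒¬ (isHi? X (suc k)) d (isHi⊇ (isHi-LK⇐ (ρ X) k<n ¬lo)))))
      (downs≤ups′ (suc k)))
    where
    isHi⊆ : ∀ {b} → IsHi X b → IsHi (LK (ρ X)) b
    isHi⊆ (I , x , e) = I , LK⊇ x , e
    isHi⊇ : ∀ {b} → IsHi (LK (ρ X)) b → IsHi X b
    isHi⊇ (I , x , e) = I , LK⊆ x , e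

  module _ (steps : Steps n up down) where

    up-ρ : ∀ {k} → suc k < n → ρX.up k ≡ not (down (suc k))
    up-ρ {k} k<n with up (suc k) in u | down (suc k) in d | steps k<n
    ... | _ | _ | rise   = dec-true (isLo? (ρ X) (suc k)) (isLo-ρ⇐ (s≤s z≤n) k<n (inj₁ u))
    ... | _ | _ | flat e = dec-true (isLo? (ρ X) (suc k)) (isLo-ρ⇐ (s≤s z≤n) k<n (inj₂ (≤-reflexive e)))
    ... | _ | _ | fall lt = dec-false (isLo? (ρ X) (suc k)) λ x →
      [ (λ t → contradiction (trans (sym t) u) λ ()) , <⇒≱ lt ]′ (isLo-ρ⇒ x)

    -- Step `k` decides: a rise leaves `k + 1` covered, a flat step stays at height 0 and leaves it
    -- uncovered, and a fall makes `k` a right end.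
    down-ρ : ∀ {k} → suc k < n → ρX.down (suc k) ≡ not (up k)
    down-ρ {k} k<n with up k in u | down k in d | steps (<-trans ≤-refl k<n)
    ... | _ | _ | rise   = dec-false (isHi? (ρ X) (suc k)) λ x →
      [ (λ t → contradiction (trans (sym t) d) λ ()) ,
        <⇒≱ (s≤s (downs≤ups′ k)) ∘ subst₂ _≤_ (count-true {up} u) (count-false {down} d) ]′ (isHi-ρ⇒ x)
    ... | _ | _ | flat e = dec-true (isHi? (ρ X) (suc k)) (isHi-ρ⇐ k<n
      (inj₂ (≤-reflexive (trans (count-false {up} u) (trans e (sym (count-false {down} d)))))))
    ... | _ | _ | fall _ = dec-true (isHi? (ρ X) (suc k)) (isHi-ρ⇐ k<n (inj₁ d))

    -- By `up-ρ` and `down-ρ`, `ρ` has complemented and exchanged the two sets of ends. `LK` undoes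
    -- this and pairs by rank, as `X` itself does.
    steps⇒fixed : LK (ρ X) ≈ X
    steps⇒fixed = (λ {I} → LK⊆ I) , (λ {I} → LK⊇ I)
      where
      not-swap : ∀ {b c} → b ≡ not c → not b ≡ c
      not-swap {c = c} refl = Bool.not-involutive c
      lo-count : ∀ {i} → suc i < n → count (not ∘ ρX.down ∘ suc) i ≡ ups i
      lo-count {i} i<n = count-cong i λ k<i → not-swap (down-ρ (<-trans (s≤s k<i) i<n))
      hi-count : ∀ {j} → suc j < n → count (not ∘ ρX.up) j ≡ downs (suc j)
      hi-count {j} j<n = trans
        (count-cong j λ k<j → not-swap (up-ρ (<-trans (s≤s k<j) j<n)))
        (sym (count-front-false j down-zero))
      LK⊆ : ∀ I → mem (LK (ρ X)) I → mem X I
      LK⊆ I@(interval (suc i) (suc j) p q r) x =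
        let ¬hi , ¬lo , e = LK-mem⇒ (ρ X) I x
            i<n = ≤-<-trans q r
        in mem⇐ {I}
          (trans (sym (not-swap (down-ρ i<n))) (cong not (dec-false (isHi? (ρ X) (suc i)) ¬hi)))
          (trans (sym (not-swap (up-ρ r))) (cong not (dec-false (isLo? (ρ X) (suc j)) ¬lo)))
          (trans (sym (lo-count i<n)) (trans e (hi-count r)))
      LK⊇ : ∀ I → mem X I → mem (LK (ρ X)) I
      LK⊇ I@(interval (suc i) (suc j) p q r) x =
        let i<n = ≤-<-trans q r in
        LK-mem⇐ (ρ X) I
          (does⇒¬ (isHi? (ρ X) (suc i)) (trans (down-ρ i<n) (cong not (up-mem x))))
          (does⇒¬ (isLo? (ρ X) (suc j)) (trans (up-ρ r) (cong not (down-mem x))))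
          (trans (lo-count i<n) (trans (mem-rank x) (sym (hi-count r))))

step-cong : ∀ {u u′ d d′ f f′ g g′} → u ≡ u′ → d ≡ d′ → f ≡ f′ → g ≡ g′ → Step u d f g → Step u′ d′ f′ g′
step-cong refl refl refl refl s = s

-- Falling needs positive height and a flat step needs height 0, so a path obeying `Steps` is
-- encoded by its rises alone.
step-determined : ∀ {u d d′ f g} → Step u d f g → Step u d′ f g → d ≡ d′
step-determined rise      rise      = refl
step-determined (fall _)  (fall _)  = refl
step-determined (fall lt) (flat e)  = contradiction (sym e) (<⇒≢ lt)
step-determined (flat e)  (fall lt) = contradiction (sym e) (<⇒≢ lt)
step-determined (flat _)  (flat _)  = refl

steps-nonneg : ∀ {n u d} → Steps n u d → ∀ {k} → k ≤ n → count d k ≤ count u k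
steps-nonneg steps {zero}  _   = z≤n
steps-nonneg {u = u} {d} steps {suc k} k<n with u k | d k | steps k<n
... | _ | _ | rise    = m≤n⇒m≤1+n (steps-nonneg steps (<⇒≤ k<n))
... | _ | _ | fall lt = lt
... | _ | _ | flat e  = ≤-reflexive (sym e)

steps-cong : ∀ {n u u′ d d′} → (∀ {k} → k < n → u k ≡ u′ k) → (∀ {k} → k < n → d k ≡ d′ k) →
             Steps n u d → Steps n u′ d′
steps-cong u≡ d≡ steps {k} k<n = step-cong (u≡ k<n) (d≡ k<n)
  (count-cong k λ j<k → u≡ (<-trans j<k k<n)) (count-cong k λ j<k → d≡ (<-trans j<k k<n)) (steps k<n)

-- Symmetric paths

Mirror : ℕ → (ℕ → Bool) → (ℕ → Bool) → Set
Mirror n u d = ∀ {k} → k < n → u (n ∸ suc k) ≡ d k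

mirror-sym : ∀ {n} u d → Mirror n u d → Mirror n d u
mirror-sym u d mir k<n = trans (sym (mir (n∸[1+k]<n k<n))) (cong u (n∸[1+[n∸[1+k]]]≡k k<n))

mirror-balanced : ∀ {n u d} → Mirror n u d → count u n ≡ count d n
mirror-balanced {n} {u} {d} mir =
  sym (subst (λ k → count u k + count d n ≡ count u n) (n∸n≡0 n) (count-reverse n mir n ≤-refl))

-- Both sides equal the common total of rises and falls. For `i = j` this says that the heights at
-- `j` and `n - j` agree.
mirror-counts : ∀ {n u d} → Mirror n u d → ∀ {i j} → i ≤ n → j ≤ n →
                count u (n ∸ j) + count d j ≡ count d (n ∸ i) + count u i
mirror-counts {n} {u} {d} mir {i} {j} i≤n j≤n =
  trans (count-reverse n mir j j≤n)
    (trans (mirror-balanced mir) (sym (count-reverse n (mirror-sym u d mir) i i≤n)))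

-- A step in the second half is a step of the first half run backwards. The height before it is the
-- height after its mirror image, so a mirrored rise gives a fall from positive height.
mirror-steps : ∀ {m u d} → Mirror (2 * m) u d → Steps m u d → Steps (2 * m) u d
mirror-steps {m} {u} {d} mir steps {k} k<n with k <? m
... | yes k<m = steps k<m
... | no  k≮m = reversed (step-cong (mir k<n) (mirror-sym u d mir k<n) refl refl (steps k′<m))
    (steps-nonneg steps (<⇒≤ k′<m)) (mirror-counts mir k<n k<n)
  where
  k′<m : 2 * m ∸ suc k < m
  k′<m = 2m∸[1+k]<m (≮⇒≥ k≮m) k<n
  reversed : ∀ {f g} → Step (d k) (u k) f g → g ≤ f →
             f + count d (suc k) ≡ g + count u (suc k) → Step (u k) (d k) (count u k) (count d k)
  reversed {f} s g≤f e with d k | u k | s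
  ... | _ | _ | rise   = fall (+-cancelˡ-≤ f _ _ (≤-trans (≤-reflexive e) (+-monoˡ-≤ _ g≤f)))
  ... | _ | _ | fall _ = rise
  ... | _ | _ | flat refl = flat (sym (+-cancelˡ-≡ f _ _ e))

-- The antichain of a symmetric path

module FromPath {n : ℕ} {u d : ℕ → Bool} (steps : Steps n u d) (mir : Mirror n u d) where

  -- Pairing rises and falls of equal rank is forced by `mem-rank` and `mem⇐`.
  pathAntichain : Antichain (𝔸 n)
  pathAntichain = record
    { mem       = λ I → u (pred (lo I)) ≡ true × d (hi I) ≡ true × count u (pred (lo I)) ≡ count d (hi I)
    ; mem?      = λ I → (u (pred (lo I)) Bool.≟ true) ×-dec ((d (hi I) Bool.≟ true)
                          ×-dec (count u (pred (lo I)) ≟ count d (hi I)))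
    ; resp      = λ { refl x → x }
    ; antichain = λ {I} {J} → anti I J
    }
    where
    anti : ∀ I J → u (pred (lo I)) ≡ true × d (hi I) ≡ true × count u (pred (lo I)) ≡ count d (hi I) →
           u (pred (lo J)) ≡ true × d (hi J) ≡ true × count u (pred (lo J)) ≡ count d (hi J) →
           I ⊑ J → I ≡ J
    anti I@(interval (suc i) j _ _ _) J@(interval (suc i′) j′ _ _ _) (ui , dj , e) (ui′ , dj′ , e′) (lJ≤ , ≤hJ) =
      interval-≡ (cong suc (count-injective {u} ui ui′ (trans e (trans same (sym e′)))))
                 (count-injective {d} dj dj′ same)
      where
      same : count d j ≡ count d j′
      same = ≤-antisym (count-mono {d} ≤hJ)
        (subst₂ _≤_ e′ e (count-mono {u} (≤-pred lJ≤)))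

  path-isLo : ∀ {k} → k < n → does (isLo? pathAntichain (suc k)) ≡ u k
  path-isLo {k} k<n with u k in uk | d k in dk | steps k<n
  ... | _ | _ | rise   = dec-true (isLo? pathAntichain (suc k)) (
    -- Balanced totals provide a fall of the same rank as the rise. It comes after `k`, since
    -- otherwise the height at `k` would be negative.
    let j , j<n , dj , e = count-attains {d} n
          (<-≤-trans (count-strict {u} uk k<n) (≤-reflexive (mirror-balanced mir)))
        k<j = ≰⇒> λ j≤k → <⇒≱ (subst₂ _<_ e (count-false {d} dk) (count-strict {d} dj (s≤s j≤k)))
                (steps-nonneg steps (<⇒≤ k<n))
    in interval (suc k) j (s≤s z≤n) k<j j<n , (uk , dj , sym e) , refl)
  ... | _ | _ | fall _ = dec-false (isLo? pathAntichain (suc k))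
    λ { (interval _ _ _ _ _ , (t , _) , refl) → contradiction (trans (sym t) uk) λ () }
  ... | _ | _ | flat _ = dec-false (isLo? pathAntichain (suc k))
    λ { (interval _ _ _ _ _ , (t , _) , refl) → contradiction (trans (sym t) uk) λ () }

  path-isHi : ∀ {k} → k < n → does (isHi? pathAntichain k) ≡ d k
  path-isHi {k} k<n with u k in uk | d k in dk | steps k<n
  ... | _ | _ | fall lt = dec-true (isHi? pathAntichain k) (
    let i , i<k , ui , e = count-attains {u} k lt
    in interval (suc i) k (s≤s z≤n) i<k k<n , (ui , dk , e) , refl)
  ... | _ | _ | rise   = dec-false (isHi? pathAntichain k)
    λ { (interval _ _ _ _ _ , (_ , t , _) , refl) → contradiction (trans (sym t) dk) λ () }
  ... | _ | _ | flat _ = dec-false (isHi? pathAntichain k)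
    λ { (interval _ _ _ _ _ , (_ , t , _) , refl) → contradiction (trans (sym t) dk) λ () }

  path-reflect : ∀ I → mem pathAntichain I → mem pathAntichain (reflect I)
  path-reflect (interval (suc i) j p q r) (ui , dj , e) =
    trans (cong u (pred[m∸n]≡m∸[1+n] n j)) (trans (mir r) dj) ,
    trans (mirror-sym u d mir i<n) ui ,
    trans (cong (count u) (pred[m∸n]≡m∸[1+n] n j))
      -- Taking the counts just past both ends of the interval adds 1 to each of the equal ranks,
      -- and these equal terms cancel from `mirror-counts`.
      (+-cancelʳ-≡ (count d (suc j)) _ _ (trans (mirror-counts mir i<n r)
        (cong (count d (n ∸ suc i) +_) (trans (count-true {u} ui) (trans (cong suc e) (sym (count-true {d} dj)))))))
    where
    i<n : i < n
    i<n = ≤-trans q (<⇒≤ r)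

-- Every Boolean sequence is turned into a path: a false bit is a down step, except at height 0.
height : (ℕ → Bool) → ℕ → ℕ
height β zero    = 0
height β (suc k) = if β k then suc (height β k) else pred (height β k)

falls : (ℕ → Bool) → ℕ → Bool
falls β k = not (β k) ∧ does (0 <? height β k)

-- `pred` truncates at 0 exactly where `falls` withholds a fall, so the truncated height is the true
-- difference of the counts.
count-height : ∀ β k → count β k ≡ height β k + count (falls β) k
count-height β zero = refl
count-height β (suc k) with β k | height β k | count-height β k
... | true  | _     | e = cong suc e
... | false | zero  | e = e
... | false | suc h | e = trans e (sym (+-suc h _))

falls-steps : ∀ {n} β → Steps n β (falls β)
falls-steps β {k} _ with β k | height β k | count-height β k
... | true  | _     | _ = rise
... | false | zero  | e = flat e
... | false | suc h | e = fall (≤-trans (s≤s (m≤n+m _ h)) (≤-reflexive (sym e)))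

module Symmetrized (m : ℕ) (β : ℕ → Bool) where

  rises′ falls′ : ℕ → Bool
  rises′ k = if does (k <? m) then β k else falls β (2 * m ∸ suc k)
  falls′ k = if does (k <? m) then falls β k else β (2 * m ∸ suc k)

  rises′-< : ∀ {k} → k < m → rises′ k ≡ β k
  rises′-< {k} k<m rewrite dec-true (k <? m) k<m = refl

  falls′-< : ∀ {k} → k < m → falls′ k ≡ falls β k
  falls′-< {k} k<m rewrite dec-true (k <? m) k<m = refl

  rises′-≥ : ∀ {k} → m ≤ k → rises′ k ≡ falls β (2 * m ∸ suc k)
  rises′-≥ {k} m≤k rewrite dec-false (k <? m) (≤⇒≯ m≤k) = refl

  falls′-≥ : ∀ {k} → m ≤ k → falls′ k ≡ β (2 * m ∸ suc k)
  falls′-≥ {k} m≤k rewrite dec-false (k <? m) (≤⇒≯ m≤k) = refl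

  symmetrized-mirror : Mirror (2 * m) rises′ falls′
  symmetrized-mirror {k} k<n with k <? m
  ... | yes k<m = trans (rises′-≥ (m≤2m∸[1+k] k<m)) (trans (cong (falls β) (n∸[1+[n∸[1+k]]]≡k k<n)) (sym (falls′-< k<m)))
  ... | no  k≮m = trans (rises′-< (2m∸[1+k]<m (≮⇒≥ k≮m) k<n)) (sym (falls′-≥ (≮⇒≥ k≮m)))

  symmetrized-steps : Steps (2 * m) rises′ falls′
  symmetrized-steps = mirror-steps symmetrized-mirror
    (steps-cong (λ k<m → sym (rises′-< k<m)) (λ k<m → sym (falls′-< k<m)) (falls-steps β))

-- Type B antichains

module _ {n : ℕ} (X Y : Antichain (𝔸 n)) where
  open Setoid (𝒜 (𝔸 n)) using (_≈_)

  isLo-cong : X ≈ Y → ∀ a → does (isLo? X a) ≡ does (isLo? Y a)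
  isLo-cong (X⊆Y , Y⊆X) a = does-⇔
    (mk⇔ (λ (I , x , e) → I , X⊆Y x , e) (λ (I , y , e) → I , Y⊆X y , e)) (isLo? X a) (isLo? Y a)

  isHi-cong : X ≈ Y → ∀ a → does (isHi? X a) ≡ does (isHi? Y a)
  isHi-cong (X⊆Y , Y⊆X) a = does-⇔
    (mk⇔ (λ (I , x , e) → I , X⊆Y x , e) (λ (I , y , e) → I , Y⊆X y , e)) (isHi? X a) (isHi? Y a)

module _ (m : ℕ) where
  open Setoid (𝒜 (𝔸 (2 * m))) using () renaming (_≈_ to _≈ᴬ_)
  open Setoid (𝒜 (𝔹 m)) using () renaming (_≈_ to _≈ᴮ_)

  restrict : Antichain (𝔸 (2 * m)) → Antichain (𝔹 m)
  restrict X = record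
    { mem       = mem X ∘ proj₁
    ; mem?      = mem? X ∘ proj₁
    ; resp      = resp X
    ; antichain = antichain X
    }

  -- An interval outside `𝔹 m` has its reflection inside, so a symmetric antichain loses no
  -- information under `restrict`.
  hat-restrict : ∀ X → (∀ I → mem X I → mem X (reflect I)) → hat m (restrict X) ≈ᴬ X
  hat-restrict X symmetric = (λ {I} → ⊆ I) , (λ {I} → ⊇ I)
    where
    ⊆ : ∀ I → mem (hat m (restrict X)) I → mem X I
    ⊆ I (inj₁ (_ , x)) = x
    ⊆ I (inj₂ (_ , x)) = subst (mem X) (reflect-involutive I) (symmetric (reflect I) x)
    ⊇ : ∀ I → mem X I → mem (hat m (restrict X)) I
    ⊇ I x with lo I + hi I ≤? 2 * m
    ... | yes le = inj₁ (le , x)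
    ... | no  gt = inj₂ (le , symmetric I x)
      where
      le : lo (reflect I) + hi (reflect I) ≤ 2 * m
      le = ≤-trans
        (+-monoˡ-≤ (2 * m ∸ lo I) (m≤n+o⇒m∸n≤o _ (hi I) (≤-trans (<⇒≤ (≰⇒> gt)) (≤-reflexive (+-comm (lo I) (hi I))))))
        (≤-reflexive (m+[n∸m]≡n (≤-trans (lo≤hi I) (<⇒≤ (hi<n I)))))

  hat-reflect : ∀ A I → mem (hat m A) I → mem (hat m A) (reflect I)
  hat-reflect A I (inj₁ x) = inj₂ (subst (mem𝔹 m A) (sym (reflect-involutive I)) x)
  hat-reflect A I (inj₂ x) = inj₁ x

  hat-cong : ∀ {A A′} → A ≈ᴮ A′ → hat m A ≈ᴬ hat m A′
  hat-cong (A⊆ , ⊆A) =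
    (λ { (inj₁ (p , x)) → inj₁ (p , A⊆ x) ; (inj₂ (p , x)) → inj₂ (p , A⊆ x) }) ,
    (λ { (inj₁ (p , x)) → inj₁ (p , ⊆A x) ; (inj₂ (p , x)) → inj₂ (p , ⊆A x) })

  -- The two inequalities force `lo I + hi I` to be `2m`. Hence reflecting members adds nothing new
  -- inside `𝔹 m`, which makes `hat` injective.
  reflect-fixed : (I : Interval (2 * m)) → lo I + hi I ≤ 2 * m →
                  lo (reflect I) + hi (reflect I) ≤ 2 * m → reflect I ≡ I
  reflect-fixed I s t = interval-≡ lo≡ (trans (cong (2 * m ∸_) (sym lo≡)) (cong hi (reflect-involutive I)))
    where
    lo≡ : lo (reflect I) ≡ lo I
    lo≡ = ≤-antisym (reflect-lo I t)
      (subst (λ J → lo J ≤ lo (reflect I)) (reflect-involutive I)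
        (reflect-lo (reflect I) (subst (λ J → lo J + hi J ≤ 2 * m) (sym (reflect-involutive I)) s)))

  hat-mem⇒ : ∀ A {I} (p : lo I + hi I ≤ 2 * m) → mem (hat m A) I → mem {𝔹 m} A (I , p)
  hat-mem⇒ A {I} p (inj₁ (p′ , x)) = subst (λ q → mem {𝔹 m} A (I , q)) (≤-irrelevant p′ p) x
  hat-mem⇒ A {I} p (inj₂ (p′ , x)) = resp {𝔹 m} A (reflect-fixed I p p′) x

  hat-injective : ∀ {A A′} → hat m A ≈ᴬ hat m A′ → A ≈ᴮ A′
  hat-injective {A} {A′} (⊆ , ⊇) =
    (λ { {I , p} x → hat-mem⇒ A′ p (⊆ (inj₁ (p , x))) }) ,
    (λ { {I , p} x → hat-mem⇒ A p (⊇ (inj₁ (p , x))) })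

  -- Reflection exchanges a right end `k` with a left end `2m - k`, and the latter is recorded at
  -- step `2m - 1 - k`.
  hat-mirror : ∀ A → Mirror (2 * m) (Path.up (hat m A)) (Path.down (hat m A))
  hat-mirror A {k} k<n = does-⇔ (mk⇔
    (λ (I , x , e) → reflect I , hat-reflect A I x ,
      trans (cong (2 * m ∸_) (trans e (suc[n∸[1+k]]≡n∸k k<n))) (m∸[m∸n]≡n (<⇒≤ k<n)))
    (λ (I , x , e) → reflect I , hat-reflect A I x ,
      trans (cong (2 * m ∸_) e) (sym (suc[n∸[1+k]]≡n∸k k<n))))
    (isLo? (hat m A) (suc (2 * m ∸ suc k))) (isHi? (hat m A) k)

-- Recovering a path from half of its rises

steps-determined : ∀ {n u d u′ d′} → Steps n u d → Steps n u′ d′ → (∀ {k} → k < n → u k ≡ u′ k) →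
                   ∀ {k} → k < n → d k ≡ d′ k
steps-determined {n} {u} {d} {u′} {d′} steps steps′ u≡ k<n = d≡ k<n (counts≡ (<⇒≤ k<n))
  where
  d≡ : ∀ {k} → k < n → count d k ≡ count d′ k → d k ≡ d′ k
  d≡ {k} k<n e = step-determined
    (step-cong (u≡ k<n) refl (count-cong k (λ j<k → u≡ (<-trans j<k k<n))) e (steps k<n)) (steps′ k<n)
  counts≡ : ∀ {k} → k ≤ n → count d k ≡ count d′ k
  counts≡ {zero}  _ = refl
  counts≡ {suc k} k<n with counts≡ (<⇒≤ k<n)
  ... | e rewrite d≡ k<n e | e = refl

mirror-determined : ∀ {m u d u′ d′} → Mirror (2 * m) u d → Mirror (2 * m) u′ d′ →
  Steps m u d → Steps m u′ d′ → (∀ {k} → k < m → u k ≡ u′ k) →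
  ∀ {k} → k < 2 * m → u k ≡ u′ k × d k ≡ d′ k
mirror-determined {m} {u} {d} {u′} {d′} mir mir′ steps steps′ u≡ {k} k<n with k <? m
... | yes k<m = u≡ k<m , steps-determined steps steps′ u≡ k<m
... | no k≮m =
  let k′<m = 2m∸[1+k]<m (≮⇒≥ k≮m) k<n
  in trans (sym (mirror-sym u d mir k<n)) (trans (steps-determined steps steps′ u≡ k′<m) (mirror-sym u′ d′ mir′ k<n)) ,
     trans (sym (mir k<n)) (trans (u≡ k′<m) (mir′ k<n))

funToFin-cong : ∀ {m n} {f g : Fin m → Fin n} → f ≗ g → funToFin f ≡ funToFin g
funToFin-cong {zero}  f≗g = refl
funToFin-cong {suc m} f≗g = cong₂ combine (f≗g zero) (funToFin-cong (f≗g ∘ suc))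

path-injective : ∀ {n} (X Y : Antichain (𝔸 n)) →
  (∀ {k} → k < n → Path.up X k ≡ Path.up Y k × Path.down X k ≡ Path.down Y k) →
  ∀ I → mem X I → mem Y I
path-injective {n} X Y same I@(interval (suc i) j p q r) x = Y.mem⇐ {I}
  (trans (sym (proj₁ (same i<n))) (X.up-mem x))
  (trans (sym (proj₂ (same r))) (X.down-mem x))
  (trans (count-cong i λ k<i → sym (proj₁ (same (<-trans k<i i<n))))
    (trans (X.mem-rank x) (count-cong j λ k<j → proj₂ (same (<-trans k<j r)))))
  where
  module X = Path X
  module Y = Path Y
  i<n : i < n
  i<n = ≤-trans q (<⇒≤ r)

-- The bijection with bit strings of length m

module Bijection (m : ℕ) where
  open Setoid (LKρ-Fixed m) using (Carrier; _≈_)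

  m≤2m : m ≤ 2 * m
  m≤2m = m≤m+n m _

  rises : Carrier → ℕ → Bool
  rises (A , _) = Path.up (hat m A)

  toBits : Carrier → Fin m → Fin 2
  toBits A k = Inverse.from 2↔Bool (rises A (toℕ k))

  extend : (Fin m → Fin 2) → ℕ → Bool
  extend f k with k <? m
  ... | yes k<m = Inverse.to 2↔Bool (f (fromℕ< k<m))
  ... | no  _   = false

  extend-toℕ : ∀ f k → Inverse.from 2↔Bool (extend f (toℕ k)) ≡ f k
  extend-toℕ f k with toℕ k <? m
  ... | yes k<m = trans (Inverse.strictlyInverseʳ 2↔Bool _) (cong f (fromℕ<-toℕ k k<m))
  ... | no  k≮m = contradiction (toℕ<n k) k≮m

  module _ (f : Fin m → Fin 2) where
    open Symmetrized m (extend f)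
    open FromPath symmetrized-steps symmetrized-mirror

    hat≈path : Setoid._≈_ (𝒜 (𝔸 (2 * m))) (hat m (restrict m pathAntichain)) pathAntichain
    hat≈path = hat-restrict m pathAntichain path-reflect

    up≡ : ∀ {k} → k < 2 * m → Path.up (hat m (restrict m pathAntichain)) k ≡ rises′ k
    up≡ {k} k<n = trans (isLo-cong (hat m (restrict m pathAntichain)) pathAntichain hat≈path (suc k)) (path-isLo k<n)

    down≡ : ∀ {k} → k < 2 * m → Path.down (hat m (restrict m pathAntichain)) k ≡ falls′ k
    down≡ {k} k<n = trans (isHi-cong (hat m (restrict m pathAntichain)) pathAntichain hat≈path k) (path-isHi k<n)

    fromBits : Carrier
    fromBits = restrict m pathAntichain , steps⇒fixed (hat m (restrict m pathAntichain))
      (steps-cong (λ k<n → sym (up≡ k<n)) (λ k<n → sym (down≡ k<n)) symmetrized-steps)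

    toBits-fromBits : toBits fromBits ≗ f
    toBits-fromBits k = trans
      (cong (Inverse.from 2↔Bool) (trans (up≡ (<-≤-trans (toℕ<n k) m≤2m)) (rises′-< (toℕ<n k))))
      (extend-toℕ f k)

  toBits-cong : ∀ {A A′} → A ≈ A′ → toBits A ≗ toBits A′
  toBits-cong {A} {A′} A≈A′ k = cong (Inverse.from 2↔Bool)
    (isLo-cong (hat m (proj₁ A)) (hat m (proj₁ A′)) (hat-cong m {proj₁ A} {proj₁ A′} A≈A′) (suc (toℕ k)))

  -- Being fixed makes both paths obey `Steps`, so equal rises in the first half give equal falls
  -- there. Symmetry extends the agreement to all `2m` steps, and equal paths have equal antichains.
  toBits-injective : ∀ {A A′} → toBits A ≗ toBits A′ → A ≈ A′
  toBits-injective {A , fixed} {A′ , fixed′} same = hat-injective m {A} {A′}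
    ((λ {I} → path-injective (hat m A) (hat m A′) same-path I) ,
     (λ {I} → path-injective (hat m A′) (hat m A) (λ k<n → let u , d = same-path k<n in sym u , sym d) I))
    where
    rises≡ : ∀ {k} → k < m → rises (A , fixed) k ≡ rises (A′ , fixed′) k
    rises≡ k<m = subst (λ k → rises (A , fixed) k ≡ rises (A′ , fixed′) k) (toℕ-fromℕ< k<m)
      (Injection.injective (Inverse⇒Injection (↔-sym 2↔Bool)) (same (fromℕ< k<m)))
    same-path : ∀ {k} → k < 2 * m →
      Path.up (hat m A) k ≡ Path.up (hat m A′) k × Path.down (hat m A) k ≡ Path.down (hat m A′) k
    same-path = mirror-determined {m} (hat-mirror m A) (hat-mirror m A′)
      (λ k<m → fixed⇒steps (hat m A) fixed (<-≤-trans k<m m≤2m))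
      (λ k<m → fixed⇒steps (hat m A′) fixed′ (<-≤-trans k<m m≤2m))
      rises≡

  to∘from : ∀ x → funToFin (toBits (fromBits (finToFun x))) ≡ x
  to∘from x = trans (funToFin-cong (toBits-fromBits (finToFun x))) (funToFin-finToFin {m} x)

  to-injective : ∀ {A A′} → funToFin (toBits A) ≡ funToFin (toBits A′) → A ≈ A′
  to-injective {A} {A′} e = toBits-injective {A} {A′} λ k →
    trans (sym (finToFun-funToFin (toBits A) k))
      (trans (cong (λ x → finToFun x k) e) (finToFun-funToFin (toBits A′) k))

proposition5p9 : (m : ℕ) → 1 ≤ m → HasCardinality (LKρ-Fixed m) (2 ^ m)
proposition5p9 m _ = record
  { to        = funToFin ∘ toBits
  ; from      = fromBits ∘ finToFun
  ; to-cong   = λ {A} {A′} A≈A′ → to-cong {A} {A′} A≈A′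
  ; from-cong = λ { refl → S.refl {fromBits (finToFun _)} }
  ; inverse   = (λ {x} {A} A≈ → trans (to-cong {A} {fromBits (finToFun x)} A≈) (to∘from x)) ,
                (λ {A} {x} e → to-injective {fromBits (finToFun x)} {A} (trans (to∘from x) e))
  }
  where
  open Bijection m
  module S = Setoid (LKρ-Fixed m)
  to-cong : ∀ {A A′} → A S.≈ A′ → funToFin (toBits A) ≡ funToFin (toBits A′)
  to-cong {A} {A′} A≈A′ = funToFin-cong (toBits-cong {A} {A′} A≈A′)
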